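{- There exists an edge-labeled tree $T$ such that $\mathrm{mhs}(T)>\mathrm{hs}(T)$.
   Context: An edge-labeled graph $G=(V(G),E(G),c)$ is a simple graph with $c\colon E(G)\to\{1,\dots,k\}$; $c(v)=\{c(\{u,v\}):\{u,v\}\in E(G)\}$ is the set of colors of vertex $v$. Edge search: a search strategy is a sequence of moves: (M1) placing a searcher on a vertex, (M2) removing a searcher from a vertex, (M3) sliding a searcher from $u$ along an edge $\{u,v\}$ to $v$. Initially all edges are contaminated; a slide along $\{u,v\}$ makes it clean; after every move, a clean edge $e$ becomes contaminated (recontamination) if some path with no searcher-occupied vertex joins an endpoint of $e$ to an endpoint of a contaminated edge. The strategy must end with all edges clean; its number of searchers is the maximum number simultaneously present. A strategy is monotone if no recontamination ever occurs. Heterogeneous search: each searcher $j$ gets a fixed color $\tilde c(j)$ before the first move; in a search $\tilde c$-strategy, searcher $j$ may be placed on $v$ only if $\tilde c(j)\in c(v)$ and slide along $e$ only if $\tilde c(j)=c(e)$. $\mathrm{hs}(G)$ is the minimum number of searchers over all search $\tilde c$-strategies (all $\tilde c$), and $\mathrm{mhs}(G)$ is the same minimum restricted to monotone search $\tilde c$-strategies. -}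

module Defs where

open import Data.Fin.Base using (Fin)
open import Data.Fin.Subset using (∣_∣)
open import Data.List.Base using (List; []; _∷_; head; last; length)
open import Data.List.Relation.Unary.All using (All)
open import Data.List.Relation.Unary.Linked using (Linked)
open import Data.List.Relation.Unary.Unique.Propositional using (Unique)
open import Data.Maybe.Base using (Maybe; just; nothing; is-just)
open import Data.Nat.Base using (ℕ; NonZero; _≤_; _⊔_)
open import Data.Product.Base using (_×_; _,_; ∃; ∃-syntax; proj₁; proj₂)
open import Data.Sum.Base using (_⊎_)
open import Data.Unit.Base using (⊤)
open import Data.Vec.Base using (tabulate)
open import Data.Vec.Functional using (Vector; updateAt)
open import Function.Base using (const)
open import Level using (0ℓ)
open import Relation.Binary.PropositionalEquality.Core using (_≡_; _≢_)
open import Relation.Nullary.Negation.Core using (¬_)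
open import Relation.Unary using (Pred; _∈_; _∉_; _∪_; _∖_; ∅; ｛_｝; Empty)

-- Edges are named by Fin size; loopless and simple make e ↦ {u,v} an
-- injection into the two-element sets of vertices, so that E(G) is a set of
-- unordered pairs.  The orientation in ends is only used through Joins.
record EdgeLabeledGraph : Set where
  field
    order size palette : ℕ

  Vertex : Set
  Vertex = Fin order

  Edge : Set
  Edge = Fin size

  Colour : Set
  Colour = Fin palette

  field
    ends : Edge → Vertex × Vertex

  Joins : Edge → Vertex → Vertex → Set
  Joins e u v = ends e ≡ (u , v) ⊎ ends e ≡ (v , u)

  field
    loopless : ∀ e → proj₁ (ends e) ≢ proj₂ (ends e)
    simple   : ∀ {e f u v} → Joins e u v → Joins f u v → e ≡ f
    c        : Edge → Colour

  Adjacent : Vertex → Vertex → Set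
  Adjacent u v = ∃[ e ] Joins e u v

  Endpoint : Vertex → Edge → Set
  Endpoint v e = ∃[ w ] Joins e v w

  coloursAt : Vertex → Pred Colour 0ℓ
  coloursAt v a = ∃[ e ] (Endpoint v e × c e ≡ a)

  -- A single vertex is a path from that vertex to itself.
  record Path (u v : Vertex) : Set where
    field
      vertices : List Vertex
      starts   : head vertices ≡ just u
      stops    : last vertices ≡ just v
      linked   : Linked Adjacent vertices
      distinct : Unique vertices

  Connected : Set
  Connected = ∀ u v → Path u v

  -- A cycle is a path on at least three vertices whose ends are adjacent.
  Acyclic : Set
  Acyclic = ∀ {u v} (P : Path u v) → 3 ≤ length (Path.vertices P) → ¬ Adjacent v u

  IsTree : Set
  IsTree = NonZero order × Connected × Acyclic

module Search (G : EdgeLabeledGraph) {k : ℕ}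
              (c̃ : Fin k → EdgeLabeledGraph.Colour G) where
  open EdgeLabeledGraph G

  Searcher : Set
  Searcher = Fin k

  -- nothing: the searcher is not on the graph.
  record State : Set₁ where
    constructor ⟨_,_⟩
    field
      position : Vector (Maybe Vertex) k
      clean    : Pred Edge 0ℓ
  open State public

  initial : State
  initial = ⟨ const nothing , ∅ ⟩

  data Move : Set where
    place  : (j : Searcher) (v : Vertex) → Move
    remove : (j : Searcher) → Move
    slide  : (j : Searcher) (u : Vertex) (e : Edge) (v : Vertex) → Move

  Legal : Move → State → Set
  Legal (place j v)     s = position s j ≡ nothing × c̃ j ∈ coloursAt v
  Legal (remove j)      s = ∃[ v ] position s j ≡ just v
  Legal (slide j u e v) s = position s j ≡ just u × Joins e u v × c̃ j ≡ c e

  -- The effect of a move before recontamination is taken into account.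
  perform : Move → State → State
  perform (place j v)     ⟨ p , C ⟩ = ⟨ updateAt p j (const (just v)) , C ⟩
  perform (remove j)      ⟨ p , C ⟩ = ⟨ updateAt p j (const nothing) , C ⟩
  perform (slide j u e v) ⟨ p , C ⟩ = ⟨ updateAt p j (const (just v)) , C ∪ ｛ e ｝ ⟩

  Occupied : State → Pred Vertex 0ℓ
  Occupied s v = ∃[ j ] position s j ≡ just v

  Recontaminated : State → Pred Edge 0ℓ
  Recontaminated s e =
    e ∈ clean s ×
    ∃[ f ] (f ∉ clean s ×
    ∃[ x ] ∃[ y ] (Endpoint x e × Endpoint y f ×
    ∃[ P ] All (_∉ Occupied s) (Path.vertices {x} {y} P)))

  recontaminate : State → State
  recontaminate s = ⟨ position s , clean s ∖ Recontaminated s ⟩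

  after : Move → State → State
  after m s = recontaminate (perform m s)

  IsSearchFrom : State → List Move → Set
  IsSearchFrom s []      = ∀ e → e ∈ clean s
  IsSearchFrom s (m ∷ S) = Legal m s × IsSearchFrom (after m s) S

  MonotoneFrom : State → List Move → Set
  MonotoneFrom s []      = ⊤
  MonotoneFrom s (m ∷ S) = Empty (Recontaminated (perform m s)) × MonotoneFrom (after m s) S

  present : State → ℕ
  present s = ∣ tabulate (λ j → is-just (position s j)) ∣

  searchersFrom : State → List Move → ℕ
  searchersFrom s []      = present s
  searchersFrom s (m ∷ S) = present s ⊔ searchersFrom (after m s) S

  IsSearchStrategy : List Move → Set
  IsSearchStrategy = IsSearchFrom initial

  Monotone : List Move → Set
  Monotone = MonotoneFrom initial

  -- The maximum number of searchers simultaneously on the graph.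
  numberOfSearchers : List Move → ℕ
  numberOfSearchers = searchersFrom initial

-- c̃ colours exactly the k searchers that the strategy uses: there is no
-- further supply of searchers of other colours from which replacements could
-- be drawn.  Asking for all k of them to be present at some moment does not
-- affect the minimum, since a searcher whose colour occurs in G can be placed
-- after the last edge is cleaned, and any other searcher is never placed.
SearchableBy : EdgeLabeledGraph → ℕ → Set
SearchableBy G k =
  ∃[ c̃ ] let open Search G {k} c̃ in
  ∃[ S ] (IsSearchStrategy S × numberOfSearchers S ≡ k)

MonotonicallySearchableBy : EdgeLabeledGraph → ℕ → Set
MonotonicallySearchableBy G k =
  ∃[ c̃ ] let open Search G {k} c̃ in
  ∃[ S ] (IsSearchStrategy S × Monotone S × numberOfSearchers S ≡ k)

IsMinimum : Pred ℕ 0ℓ → Pred ℕ 0ℓ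
IsMinimum P m = m ∈ P × (∀ {n} → n ∈ P → m ≤ n)

-- IsHs G h and IsMhs G m say hs(G) = h and mhs(G) = m.
IsHs : EdgeLabeledGraph → Pred ℕ 0ℓ
IsHs G = IsMinimum (SearchableBy G)

IsMhs : EdgeLabeledGraph → Pred ℕ 0ℓ
IsMhs G = IsMinimum (MonotonicallySearchableBy G)

module Submission where

-- The tree is a spider whose legs are coloured 0,1,0,2 and 2,0,1 and 2,0,1 from
-- the centre outwards.  Every colour needs a searcher, and one searcher per
-- colour suffices if one edge may be given up and cleaned again.  Four searchers
-- can do this monotonically, but three cannot: they would have distinct colours,
-- so the state of the search is governed by the clean set, which only grows, and
-- by which colours guard its boundary vertices.  An exhaustive exploration of
-- these finitely many configurations never cleans the whole spider.

open import Defs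
open import Data.Bool.Base using (Bool; true; false; _∧_; if_then_else_)
import Data.Bool.Properties as Bool
open import Data.Fin.Base using (Fin; zero; suc; toℕ; punchOut)
open import Data.Fin.Patterns
open import Data.Fin.Properties using (any?; all?; _≟_; injective⇒≤; punchOut-injective)
open import Data.Fin.Subset using (Subset; inside; outside; ⁅_⁆; _∩_)
  renaming (_∈_ to _∈ˢ_; _∉_ to _∉ˢ_; _∪_ to _∪ˢ_; ⊥ to ⊥ˢ; ⊤ to ⊤ˢ)
open import Data.Fin.Subset.Properties
  using (_∈?_; ∉⊥; x∈⁅x⁆; x∈⁅y⁆⇒x≡y; x∈p∪q⁻; x∈p∪q⁺; p⊆p∪q; p∩q⊆p; ⊆-antisym; ⊆⊤)
open import Data.List.Base using (List; []; _∷_; _++_; map; concatMap; filter; allFin; head; last)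
open import Data.List.Membership.Propositional using (lose; find) renaming (_∈_ to _∈ᴸ_)
open import Data.List.Membership.Propositional.Properties
  using (∈-map⁺; ∈-filter⁺; ∈-concatMap⁺; ∈-allFin; ∈-++⁺ˡ; ∈-++⁺ʳ)
open import Data.List.Relation.Unary.All as All using (All; []; _∷_)
open import Data.List.Relation.Unary.AllPairs using ([]; _∷_)
open import Data.List.Relation.Unary.Any as Any using (Any; here)
open import Data.List.Relation.Unary.Linked using (Linked; [-]; _∷_; linked?)
open import Data.List.Relation.Unary.Unique.Propositional using (Unique)
open import Data.Maybe.Base using (Maybe; just; nothing; maybe)
import Data.Maybe.Properties as Maybe
open import Data.Nat.Base using (ℕ; zero; suc; _≤_; _>_; s≤s)
import Data.Nat.Properties as ℕ
open import Data.Product.Base as Product using (_×_; _,_; ∃-syntax; proj₁; proj₂)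
import Data.Product.Properties as Product
open import Data.Sum.Base as Sum using (_⊎_; inj₁; inj₂; [_,_]′)
open import Data.Unit.Base using (⊤; tt)
open import Data.Vec.Base as Vec using (Vec; []; _∷_; lookup; replicate; tabulate; _[_]≔_)
open import Data.Vec.Functional using (Vector; updateAt)
open import Data.Vec.Functional.Properties using (updateAt-updates; updateAt-minimal)
open import Data.Vec.Properties using (lookup∘update; lookup∘update′; lookup-replicate)
open import Function.Base using (_∘_; id; const)
open import Function.Definitions using (Injective)
open import Level using (0ℓ)
open import Relation.Binary.PropositionalEquality
open import Relation.Nullary.Decidable
  using (Dec; yes; no; does; _because_; map′; _×-dec_; _⊎-dec_; _→-dec_; ¬?;
         from-yes; True; toWitness; decidable-stable)
open import Relation.Nullary.Negation using (¬_; contradiction)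
open import Relation.Unary using (Pred; Decidable; _∈_; _∉_; Empty)

-- Incidence, boundary vertices and a criterion for acyclicity.

module Graph (G : EdgeLabeledGraph) where
  open EdgeLabeledGraph G

  joins? : ∀ e u v → Dec (Joins e u v)
  joins? e u v = Product.≡-dec _≟_ _≟_ (ends e) (u , v) ⊎-dec Product.≡-dec _≟_ _≟_ (ends e) (v , u)

  joins-sym : ∀ {e u v} → Joins e u v → Joins e v u
  joins-sym = [ inj₂ , inj₁ ]′

  adjacent? : ∀ u v → Dec (Adjacent u v)
  adjacent? u v = any? λ e → joins? e u v

  endpoint? : ∀ v e → Dec (Endpoint v e)
  endpoint? v e = map′
    (λ { (inj₁ refl) → _ , inj₁ refl ; (inj₂ refl) → _ , inj₂ refl })
    (λ { (_ , inj₁ p) → inj₁ (cong proj₁ p) ; (_ , inj₂ p) → inj₂ (cong proj₂ p) })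
    (proj₁ (ends e) ≟ v ⊎-dec proj₂ (ends e) ≟ v)

  coloursAt? : ∀ v a → Dec (coloursAt v a)
  coloursAt? v a = any? λ e → endpoint? v e ×-dec c e ≟ a

  Boundary : Subset size → Vertex → Set
  Boundary D v = (∃[ e ] (Endpoint v e × e ∈ˢ D)) × (∃[ f ] (Endpoint v f × f ∉ˢ D))

  boundary? : ∀ D v → Dec (Boundary D v)
  boundary? D v = any? (λ e → endpoint? v e ×-dec e ∈? D) ×-dec any? (λ f → endpoint? v f ×-dec ¬? (f ∈? D))

  -- `side e` names the two parts into which deleting `e` splits the graph; acyclicity thus becomes
  -- a finite check on edges.
  module _ (side : Edge → Vertex → Bool)
           (separates : ∀ e {u v} → Joins e u v → side e u ≢ side e v)
           (constant : ∀ {e f u v} → f ≢ e → Joins f u v → side e u ≡ side e v) where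

    private
      -- The list avoids `u`, an end of `e`, so none of its steps is `e`.
      side-last : ∀ {e u v x y xs} → Joins e u v → Linked Adjacent (x ∷ xs) → All (u ≢_) (x ∷ xs) →
                  last (x ∷ xs) ≡ just y → side e x ≡ side e y
      side-last j [-] _ refl = refl
      side-last {e} j ((f , k) ∷ l) (u≢x ∷ u≢y ∷ u≢) eq with f ≟ e
      ... | no f≢e = trans (constant f≢e k) (side-last j l (u≢y ∷ u≢) eq)
      ... | yes refl with j | k
      ...   | inj₁ p | inj₁ q = contradiction (cong proj₁ (trans (sym p) q)) u≢x
      ...   | inj₁ p | inj₂ q = contradiction (cong proj₁ (trans (sym p) q)) u≢y
      ...   | inj₂ p | inj₁ q = contradiction (cong proj₂ (trans (sym p) q)) u≢y
      ...   | inj₂ p | inj₂ q = contradiction (cong proj₂ (trans (sym p) q)) u≢x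

      same-end : ∀ {e u v y} → Joins e u v → Joins e u y → v ≡ y
      same-end (inj₁ p) (inj₁ q) = cong proj₂ (trans (sym p) q)
      same-end (inj₂ p) (inj₂ q) = cong proj₁ (trans (sym p) q)
      same-end (inj₁ p) (inj₂ q) with refl ← trans (sym p) q = refl
      same-end (inj₂ p) (inj₁ q) with refl ← trans (sym p) q = refl

      last-∈ : ∀ {x y : Vertex} xs → last (x ∷ xs) ≡ just y → y ∈ᴸ (x ∷ xs)
      last-∈ []       refl = here refl
      last-∈ (z ∷ xs) eq   = Any.there (last-∈ xs eq)

    -- A path from u to v that does not start with the edge uv never uses it
    -- and so never leaves the side of u.
    acyclic : Acyclic
    acyclic record { vertices = x ∷ y ∷ z ∷ zs ; starts = refl ; stops = stops
                   ; linked = (f , k) ∷ l ; distinct = u≢ ∷ (y≢ ∷ _) } (s≤s (s≤s (s≤s _))) (e , j) with f ≟ e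
    ... | no f≢e  = separates e (joins-sym j) (trans (constant f≢e k) (side-last (joins-sym j) l u≢ stops))
    -- If the first step is `e`, it already reaches `v`, which distinctness forbids to occur again
    -- as the last vertex.
    ... | yes refl = All.lookup y≢ (last-∈ zs stops) (sym (same-end (joins-sym j) k))

-- Searches computed on finite edge sets.

module Searching (G : EdgeLabeledGraph) {k : ℕ} (c̃ : Fin k → EdgeLabeledGraph.Colour G) where
  open EdgeLabeledGraph G
  open Graph G
  open Search G c̃

  position? : ∀ s j v → Dec (position s j ≡ just v)
  position? s j v = Maybe.≡-dec _≟_ (position s j) (just v)

  occupied? : ∀ s v → Dec (v ∈ Occupied s)
  occupied? s v = any? λ j → position? s j v

  legal? : ∀ m s → Dec (Legal m s)
  legal? (place j v)     s = Maybe.≡-dec _≟_ (position s j) nothing ×-dec coloursAt? v (c̃ j)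
  legal? (remove j)      s = any? λ v → position? s j v
  legal? (slide j u e v) s = position? s j u ×-dec joins? e u v ×-dec c̃ j ≟ c e

  gain : Move → Subset size → Subset size
  gain (place _ _)     D = D
  gain (remove _)      D = D
  gain (slide _ _ e _) D = D ∪ˢ ⁅ e ⁆

  -- A local, decidable substitute for the quantification over paths: when `D` is the clean set, it
  -- is equivalent to the absence of recontamination.
  record Settled (D : Subset size) (p : Vector (Maybe Vertex) k) : Set where
    constructor settle
    field occupant : ∀ v → Boundary D v → ∃[ j ] p j ≡ just v
  open Settled public

  settled? : ∀ D s → Dec (Settled D (position s))
  settled? D s = map′ settle occupant (all? λ v → boundary? D v →-dec occupied? s v)

  record Tracks (s : State) (D : Subset size) : Set where
    field
      clean⊆ : ∀ e → e ∈ clean s → e ∈ˢ D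
      ⊆clean : ∀ e → e ∈ˢ D → e ∈ clean s
  open Tracks public

  gain⊆clean : ∀ m s D → (∀ e → e ∈ˢ D → e ∈ clean s) → ∀ e → e ∈ˢ gain m D → e ∈ clean (perform m s)
  gain⊆clean (place _ _)     s D D⊆ = D⊆
  gain⊆clean (remove _)      s D D⊆ = D⊆
  gain⊆clean (slide _ _ f _) s D D⊆ e e∈ with x∈p∪q⁻ D ⁅ f ⁆ e∈
  ... | inj₁ e∈D = inj₁ (D⊆ e e∈D)
  ... | inj₂ e∈f = inj₂ (sym (x∈⁅y⁆⇒x≡y f e∈f))

  clean⊆gain : ∀ m s D → (∀ e → e ∈ clean s → e ∈ˢ D) → ∀ e → e ∈ clean (perform m s) → e ∈ˢ gain m D
  clean⊆gain (place _ _)     s D ⊆D = ⊆D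
  clean⊆gain (remove _)      s D ⊆D = ⊆D
  clean⊆gain (slide _ _ f _) s D ⊆D e (inj₁ e∈)   = x∈p∪q⁺ (inj₁ (⊆D e e∈))
  clean⊆gain (slide _ _ f _) s D ⊆D _ (inj₂ refl) = x∈p∪q⁺ (inj₂ (x∈⁅x⁆ f))

  tracks-perform : ∀ m {s D} → Tracks s D → Tracks (perform m s) (gain m D)
  tracks-perform m {s} {D} tracks = record
    { clean⊆ = clean⊆gain m s D (clean⊆ tracks) ; ⊆clean = gain⊆clean m s D (⊆clean tracks) }

  tracks-recontaminate : ∀ {s D} → Tracks s D → Empty (Recontaminated s) → Tracks (recontaminate s) D
  tracks-recontaminate tracks none = record
    { clean⊆ = λ e → clean⊆ tracks e ∘ proj₁ ; ⊆clean = λ e e∈ → ⊆clean tracks e e∈ , none e }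

  tracks-initial : Tracks initial ⊥ˢ
  tracks-initial = record { clean⊆ = λ _ () ; ⊆clean = λ e e∈ → contradiction e∈ ∉⊥ }

  private
    settled-at : ∀ {D x e f} s → Settled D (position s) → x ∉ Occupied s →
                 Endpoint x e → Endpoint x f → e ∈ˢ D → f ∈ˢ D
    settled-at {D} {x} {e} {f} s settled x∉ xe xf e∈ =
      decidable-stable (f ∈? D) λ f∉ → x∉ (occupant settled x ((e , xe , e∈) , (f , xf , f∉)))

    -- The edges at an unoccupied vertex lie all in `D` or all outside, so membership is handed on
    -- along the path.
    settled-along : ∀ {D x y e f} s xs → Settled D (position s) → Linked Adjacent xs → All (_∉ Occupied s) xs →
                    head xs ≡ just x → last xs ≡ just y → Endpoint x e → Endpoint y f → e ∈ˢ D → f ∈ˢ D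
    settled-along s (_ ∷ []) settled _ (x∉ ∷ _) refl refl xe yf = settled-at s settled x∉ xe yf
    settled-along s (x ∷ y ∷ xs) settled ((h , xhy) ∷ l) (x∉ ∷ xs∉) refl eq xe yf e∈ =
      settled-along s (y ∷ xs) settled l xs∉ refl eq (x , joins-sym xhy) yf
        (settled-at s settled x∉ xe (y , xhy) e∈)

  -- A lower bound `D` for the clean set suffices: membership would spread along the unguarded path
  -- to the contaminated edge.
  settled-uncontaminated : ∀ {D} s → Settled D (position s) → (∀ e → e ∈ˢ D → e ∈ clean s) →
                           ∀ e → e ∈ˢ D → e ∉ Recontaminated s
  settled-uncontaminated s settled D⊆ e e∈ (_ , f , f∉ , x , y , xe , yf , P , P∉) =
    f∉ (D⊆ f (settled-along s (Path.vertices P) settled (Path.linked P) P∉ (Path.starts P) (Path.stops P) xe yf e∈))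

  -- An unoccupied boundary vertex is by itself a path from a clean edge to a contaminated one.
  uncontaminated-settled : ∀ {D s} → Tracks s D → Empty (Recontaminated s) → Settled D (position s)
  uncontaminated-settled {D} {s} tracks none = settle λ v ((e , ve , e∈) , (f , vf , f∉)) →
    decidable-stable (occupied? s v) λ v∉ → none e
      (⊆clean tracks e e∈ , f , f∉ ∘ clean⊆ tracks f , v , v , ve , vf ,
       record { vertices = v ∷ [] ; starts = refl ; stops = refl ; linked = [-] ; distinct = [] ∷ [] } , v∉ ∷ [])

  -- A single round of recontamination; Sweeps checks afterwards that it was enough.
  erode : State → Subset size → Subset size
  erode s D = D ∩ tabulate λ e → does (all? λ v → endpoint? v e →-dec boundary? D v →-dec occupied? s v)

  -- A certificate for searches that may be non-monotone. `D` serves as a lower bound for the clean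
  -- set, so the exact recontamination is never computed.
  Sweeps : State → Subset size → List Move → Set
  Sweeps s D []      = ∀ e → e ∈ˢ D
  Sweeps s D (m ∷ S) = Legal m s × Settled D′ (position (perform m s)) × Sweeps (after m s) D′ S
    where D′ = erode (perform m s) (gain m D)

  sweeps? : ∀ s D S → Dec (Sweeps s D S)
  sweeps? s D []      = all? λ e → e ∈? D
  sweeps? s D (m ∷ S) = legal? m s ×-dec settled? D′ (perform m s) ×-dec sweeps? (after m s) D′ S
    where D′ = erode (perform m s) (gain m D)

  sweeps-search : ∀ {s D} S → (∀ e → e ∈ˢ D → e ∈ clean s) → Sweeps s D S → IsSearchFrom s S
  sweeps-search         []      D⊆ all = λ e → D⊆ e (all e)
  sweeps-search {s} {D} (m ∷ S) D⊆ (legal , settled , sweeps) =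
    legal , sweeps-search S (λ e e∈ → D′⊆ e e∈ , settled-uncontaminated (perform m s) settled D′⊆ e e∈) sweeps
    where
    D′⊆ : ∀ e → e ∈ˢ erode (perform m s) (gain m D) → e ∈ clean (perform m s)
    D′⊆ e = gain⊆clean m s D D⊆ e ∘ p∩q⊆p (gain m D) _

  -- The certificate for monotonicity: if `D` starts as the exact clean set, settledness after each
  -- move keeps it exact.
  Progresses : State → Subset size → List Move → Set
  Progresses s D []      = ⊤
  Progresses s D (m ∷ S) = Settled (gain m D) (position (perform m s)) × Progresses (after m s) (gain m D) S

  progresses? : ∀ s D S → Dec (Progresses s D S)
  progresses? s D []      = yes tt
  progresses? s D (m ∷ S) = settled? (gain m D) (perform m s) ×-dec progresses? (after m s) (gain m D) S

  progresses-monotone : ∀ {s D} S → Tracks s D → Progresses s D S → MonotoneFrom s S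
  progresses-monotone         []      tracks _ = tt
  progresses-monotone {s} {D} (m ∷ S) tracks (settled , progresses) =
    none , progresses-monotone S (tracks-recontaminate tracks′ none) progresses
    where
    tracks′ : Tracks (perform m s) (gain m D)
    tracks′ = tracks-perform m tracks
    none : Empty (Recontaminated (perform m s))
    none e r = settled-uncontaminated (perform m s) settled (⊆clean tracks′) e (clean⊆ tracks′ e (proj₁ r)) r

  search-by-computation : ∀ S → True (sweeps? initial ⊥ˢ S) → IsSearchStrategy S
  search-by-computation S = sweeps-search S (⊆clean tracks-initial) ∘ toWitness

  monotone-by-computation : ∀ S → True (progresses? initial ⊥ˢ S) → Monotone S
  monotone-by-computation S = progresses-monotone S tracks-initial ∘ toWitness

  -- Only slides clean edges, and a slide requires equal colours.
  colour-used : ∀ {s} S → IsSearchFrom s S → ∀ e → e ∈ clean s ⊎ (∃[ j ] c̃ j ≡ c e)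
  colour-used []                    all          e = inj₁ (all e)
  colour-used (place j v ∷ S)       (_ , search) e = Sum.map₁ proj₁ (colour-used S search e)
  colour-used (remove j ∷ S)        (_ , search) e = Sum.map₁ proj₁ (colour-used S search e)
  colour-used (slide j u f v ∷ S) ((_ , _ , cj≡cf) , search) e with colour-used S search e
  ... | inj₁ (inj₁ e∈ , _)    = inj₁ e∈
  ... | inj₁ (inj₂ refl , _)  = inj₂ (j , cj≡cf)
  ... | inj₂ used             = inj₂ used

-- Tables over all subsets of a finite set.

-- Indexed by Subset n, as a binary trie.
data Table (A : Set) : ℕ → Set where
  leaf : A → Table A zero
  node : ∀ {n} → Table A n → Table A n → Table A (suc n)

constant : ∀ {A n} → A → Table A n
constant {n = zero}  x = leaf x
constant {n = suc n} x = node (constant x) (constant x)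

at : ∀ {A n} → Table A n → Subset n → A
at (leaf x)   []            = x
at (node t u) (outside ∷ p) = at t p
at (node t u) (inside  ∷ p) = at u p

modify : ∀ {A n} → (A → A) → Subset n → Table A n → Table A n
modify f []            (leaf x)   = leaf (f x)
modify f (outside ∷ p) (node t u) = node (modify f p t) u
modify f (inside  ∷ p) (node t u) = node t (modify f p u)

everySubset? : ∀ {n} {P : Pred (Subset n) 0ℓ} → Decidable P → Dec (∀ p → P p)
everySubset? {zero}  P? = map′ (λ { x [] → x }) (λ f → f []) (P? [])
everySubset? {suc n} P? = map′
  (λ { (x , y) (outside ∷ p) → x p ; (x , y) (inside ∷ p) → y p })
  (λ f → f ∘ (outside ∷_) , f ∘ (inside ∷_))
  (everySubset? (P? ∘ (outside ∷_)) ×-dec everySubset? (P? ∘ (inside ∷_)))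

-- Exploration of cleaned sets together with guards by colour.

module Exploration (G : EdgeLabeledGraph) where
  open EdgeLabeledGraph G
  open Graph G

  -- A partial record of positions, by colour: nothing means unknown, not absent.
  Guards : Set
  Guards = Vec (Maybe Vertex) palette

  Config : Set
  Config = Subset size × Guards

  Free : Guards → Vertex → Pred Colour 0ℓ
  Free g v a = lookup g a ≡ nothing ⊎ lookup g a ≡ just v

  free? : ∀ g v a → Dec (Free g v a)
  free? g v a = Maybe.≡-dec _≟_ (lookup g a) nothing ⊎-dec Maybe.≡-dec _≟_ (lookup g a) (just v)

  postable? : ∀ g v → Decidable (λ a → Free g v a × coloursAt v a)
  postable? g v a = free? g v a ×-dec coloursAt? v a

  -- Only the Boolean is inspected, so choosing a branch forces no proof.
  when : ∀ {A : Set} {P : Set} → Dec P → List A → List A → List A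
  when (true  because _) xs ys = xs
  when (false because _) xs ys = ys

  -- Ways to make explicit who stands on v: if v must be guarded, then some searcher,
  -- possibly one whose position g does not record, is there.
  coverings : Subset size → Guards → Vertex → List Guards
  coverings D g v = when (boundary? D v)
    (map (λ a → g [ a ]≔ just v) (filter (postable? g v) (allFin palette)))
    (g ∷ [])

  -- Models the moves that clean nothing new. The position of colour `a` is forgotten, which only
  -- enlarges the set of states described; an unrecorded colour changes nothing.
  releases : Config → Colour → List Guards
  releases (C , g) a = maybe (coverings C (g [ a ]≔ nothing)) [] (lookup g a)

  -- The slider itself guards `v`, so `u` is the vertex whose guard may have to be named.
  slides : Config → Edge → Vertex → Vertex → List Guards
  slides (C , g) e u v = when (free? g u (c e)) (coverings (C ∪ˢ ⁅ e ⁆) (g [ c e ]≔ just v) u) []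

  advances : Config → Edge → List Guards
  advances x@(C , _) e = when (e ∈? C) []
    (slides x e (proj₁ (ends e)) (proj₂ (ends e)) ++ slides x e (proj₂ (ends e)) (proj₁ (ends e)))

  successors : Config → List Config
  successors x@(C , _) =
    concatMap (λ a → map (C ,_) (releases x a)) (allFin palette) ++
    concatMap (λ e → map (C ∪ˢ ⁅ e ⁆ ,_) (advances x e)) (allFin size)

  ∈releases : ∀ {C} g {a v h} → lookup g a ≡ just v → h ∈ᴸ coverings C (g [ a ]≔ nothing) v → h ∈ᴸ releases (C , g) a
  ∈releases g eq h∈ rewrite eq = h∈

  -- A record with fewer entries describes more states, so a stored `g` subsumes `h`.
  _⊑_ : Guards → Guards → Set
  g ⊑ h = ∀ a → lookup g a ≡ nothing ⊎ lookup g a ≡ lookup h a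

  _⊑?_ : ∀ g h → Dec (g ⊑ h)
  g ⊑? h = all? λ a → Maybe.≡-dec _≟_ (lookup g a) nothing ⊎-dec Maybe.≡-dec _≟_ (lookup g a) (lookup h a)

  Family : Set
  Family = Table (List Guards) size

  Matched : Family → Pred Config 0ℓ
  Matched R (C , h) = Any (_⊑ h) (at R C)

  matched? : ∀ R → Decidable (Matched R)
  matched? R (C , h) = Any.any? (_⊑? h) (at R C)

  start : Config
  start = ⊥ˢ , replicate _ nothing

  -- An inductive invariant checked on the finished table; `explore` and `relax` then need no
  -- correctness proof.
  Closed : Family → Set
  Closed R = Matched R start × (∀ C → All (λ g → All (Matched R) (successors (C , g))) (at R C))

  closed? : Decidable Closed
  closed? R = matched? R start ×-dec everySubset? λ C →
    All.all? (λ g → All.all? (matched? R) (successors (C , g))) (at R C)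

  -- Guards off the boundary can be forgotten, which keeps the family small.
  relax : Config → Guards
  relax (C , g) = Vec.map (λ m → maybe (λ v → if does (boundary? C v) then just v else nothing) nothing m) g

  explore : ℕ → List Config → Family → Family
  explore zero    _          R = R
  explore (suc n) []         R = R
  explore (suc n) (x ∷ todo) R with does (matched? R x)
  ... | true  = explore n todo R
  -- Successors are taken of the relaxed configuration because that is the one stored, hence the one
  -- `Closed` examines.
  ... | false = explore n (successors (proj₁ x , relax x) ++ todo) (modify (relax x ∷_) (proj₁ x) R)

  -- Soundness of the exploration for monotone search with distinct colours.

  module Invariant {k} (c̃ : Fin k → Colour) (c̃-injective : Injective _≡_ _≡_ c̃)
                   (R : Family) (closed : Closed R) (unfinished : at R ⊤ˢ ≡ []) where
    open Search G c̃
    open Searching G c̃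

    Positions : Set
    Positions = Vector (Maybe Vertex) k

    Admissible : Positions → Set
    Admissible p = ∀ j v → p j ≡ just v → coloursAt v (c̃ j)

    record Guarded (p : Positions) (g : Guards) : Set where
      constructor guarding
      field guard : ∀ a v → lookup g a ≡ just v → ∃[ j ] (c̃ j ≡ a × p j ≡ just v)
    open Guarded

    Represented : Positions → Subset size → Set
    Represented p C = ∃[ g ] (g ∈ᴸ at R C × Guarded p g)

    record Sound (s : State) : Set where
      constructor sound
      field
        cleaned     : Subset size
        tracks      : Tracks s cleaned
        admissible  : Admissible (position s)
        represented : Represented (position s) cleaned

    module _ {p : Positions} where

      -- Injectivity of `c̃` enters here: the searcher bearing the colour of `j` is `j` itself.
      guard-position : ∀ {g j v} → Guarded p g → lookup g (c̃ j) ≡ just v → p j ≡ just v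
      guard-position {v = v} guarded eq with i , ci≡cj , pi ← guard guarded _ v eq with refl ← c̃-injective ci≡cj = pi

      updated : ∀ j x i → i ≡ j × updateAt p j (const x) i ≡ x ⊎ i ≢ j × updateAt p j (const x) i ≡ p i
      updated j x i with i ≟ j
      ... | yes refl = inj₁ (refl , updateAt-updates i p)
      ... | no  i≢j  = inj₂ (i≢j , updateAt-minimal i j p i≢j)

      admissible-update : ∀ j x → (∀ v → x ≡ just v → coloursAt v (c̃ j)) →
                          Admissible p → Admissible (updateAt p j (const x))
      admissible-update j x ok admissible i v eq with updated j x i
      ... | inj₁ (refl , new) = ok v (trans (sym new) eq)
      ... | inj₂ (_    , old) = admissible i v (trans (sym old) eq)

      guarded-idle : ∀ {g} j x → lookup g (c̃ j) ≡ nothing → Guarded p g → Guarded (updateAt p j (const x)) g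
      guarded-idle {g} j x idle guarded = guarding still
        where
        still : ∀ a v → lookup g a ≡ just v → ∃[ i ] (c̃ i ≡ a × updateAt p j (const x) i ≡ just v)
        still a v eq with guard guarded a v eq
        ... | i , refl , pi with updated j x i
        ...   | inj₁ (refl , _) = contradiction (trans (sym idle) eq) λ ()
        ...   | inj₂ (_ , old)  = i , refl , trans old pi

      -- Entries of other colours belong to searchers other than `j`. The new entry `y` may record
      -- less than the true position `x`.
      guarded-update : ∀ {g a} j x y → c̃ j ≡ a → (∀ v → y ≡ just v → x ≡ just v) →
                       Guarded p g → Guarded (updateAt p j (const x)) (g [ a ]≔ y)
      guarded-update {g} {a} j x y cj≡a y⊑x guarded = guarding now
        where
        now : ∀ b v → lookup (g [ a ]≔ y) b ≡ just v → ∃[ i ] (c̃ i ≡ b × updateAt p j (const x) i ≡ just v)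
        now b v eq with b ≟ a
        ... | yes refl = j , cj≡a , trans (updateAt-updates j p) (y⊑x v (trans (sym (lookup∘update a g y)) eq))
        ... | no  b≢a with i , ci≡b , pi ← guard guarded b v (trans (sym (lookup∘update′ b≢a g y)) eq) =
          i , ci≡b , trans (updateAt-minimal i j p λ { refl → b≢a (trans (sym ci≡b) cj≡a) }) pi

      guarded-⊑ : ∀ {g h} → g ⊑ h → Guarded p h → Guarded p g
      guarded-⊑ {g} {h} g⊑h guarded = guarding λ a v eq →
        [ (λ none → contradiction (trans (sym none) eq) λ ()) , (λ same → guard guarded a v (trans (sym same) eq)) ]′ (g⊑h a)

      matched-represented : ∀ {D h} → Matched R (D , h) → Guarded p h → Represented p D
      matched-represented {h = h} matched guarded with g , g∈ , g⊑h ← find matched = g , g∈ , guarded-⊑ {g} {h} g⊑h guarded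

      -- Settledness supplies an occupant of a boundary vertex. Admissibility puts its colour there
      -- and injectivity excludes a conflicting record, so `coverings` lists it.
      covering : ∀ {g} D v → Admissible p → Settled D p → Guarded p g →
                 ∃[ h ] (h ∈ᴸ coverings D g v × Guarded p h)
      covering {g} D v admissible settled guarded with boundary? D v
      ... | no  _ = g , here refl , guarded
      ... | yes b with occupant settled v b
      ...   | j , pj = g [ c̃ j ]≔ just v ,
                       ∈-map⁺ _ (∈-filter⁺ (postable? g v) (∈-allFin (c̃ j)) (free , admissible j v pj)) , guarding posted
        where
        free : Free g v (c̃ j)
        free with lookup g (c̃ j) in eq
        ... | nothing = inj₁ refl
        ... | just w  = inj₂ (trans (sym (guard-position guarded eq)) pj)

        posted : ∀ a w → lookup (g [ c̃ j ]≔ just v) a ≡ just w → ∃[ i ] (c̃ i ≡ a × p i ≡ just w)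
        posted a w eq with a ≟ c̃ j
        ... | yes refl = j , refl , trans pj (trans (sym (lookup∘update a g (just v))) eq)
        ... | no  a≢   = guard guarded a w (trans (sym (lookup∘update′ a≢ g (just v))) eq)

    successor-matched : ∀ {C g x} → g ∈ᴸ at R C → x ∈ᴸ successors (C , g) → Matched R x
    successor-matched {C} g∈ x∈ = All.lookup (All.lookup (proj₂ closed C) g∈) x∈

    -- Serves placements, removals and slides over clean edges alike, since all of them leave `C` as
    -- it is.
    released : ∀ {p C} j x → let p′ = updateAt p j (const x) in
               Admissible p′ → Settled C p′ → Represented p C → Represented p′ C
    released {p} {C} j x admissible settled (g , g∈ , guarded) with lookup g (c̃ j) in eq
    ... | nothing = g , g∈ , guarded-idle j x eq guarded
    ... | just v with h , h∈ , guarded′ ← covering C v admissible settled (guarded-update j x nothing refl (λ _ ()) guarded) =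
      matched-represented
        (successor-matched g∈ (∈-++⁺ˡ (∈-concatMap⁺ _ (lose (∈-allFin (c̃ j)) (∈-map⁺ (C ,_) (∈releases g eq h∈))))))
        guarded′

    advanced : ∀ {p C} j u e v → let p′ = updateAt p j (const (just v)) in
               p j ≡ just u → Joins e u v → c̃ j ≡ c e → e ∉ˢ C →
               Admissible p′ → Settled (C ∪ˢ ⁅ e ⁆) p′ → Represented p C → Represented p′ (C ∪ˢ ⁅ e ⁆)
    advanced {p} {C} j u e v pj≡u euv cj≡ce e∉C admissible settled (g , g∈ , guarded)
      with h , h∈ , guarded′ ← covering (C ∪ˢ ⁅ e ⁆) u admissible settled
                                 (guarded-update j (just v) (just v) cj≡ce (λ _ → id) guarded) =
      matched-represented
        (successor-matched g∈ (∈-++⁺ʳ _ (∈-concatMap⁺ _ (lose (∈-allFin e) (∈-map⁺ (C ∪ˢ ⁅ e ⁆ ,_) (∈advances h∈))))))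
        guarded′
      where
      free : Free g u (c e)
      free with lookup g (c e) in eq
      ... | nothing = inj₁ refl
      ... | just w  = inj₂ (trans (sym (guard-position guarded (trans (cong (lookup g) cj≡ce) eq))) pj≡u)

      ∈slides : ∀ {h} → h ∈ᴸ coverings (C ∪ˢ ⁅ e ⁆) (g [ c e ]≔ just v) u → h ∈ᴸ slides (C , g) e u v
      ∈slides h∈ with free? g u (c e)
      ... | yes _ = h∈
      ... | no ¬f = contradiction free ¬f

      ∈advances : ∀ {h} → h ∈ᴸ coverings (C ∪ˢ ⁅ e ⁆) (g [ c e ]≔ just v) u → h ∈ᴸ advances (C , g) e
      ∈advances {h} h∈ with e ∈? C
      ... | yes e∈C = contradiction e∈C e∉C
      ... | no  _   = [ (λ eq → ∈-++⁺ˡ (subst (λ (x , y) → h ∈ᴸ slides (C , g) e x y) (sym eq) (∈slides h∈)))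
                      , (λ eq → ∈-++⁺ʳ (slides (C , g) e (proj₁ (ends e)) (proj₂ (ends e)))
                          (subst (λ (x , y) → h ∈ᴸ slides (C , g) e y x) (sym eq) (∈slides h∈)))
                      ]′ euv

    sound-after : ∀ m {s} → Sound s → Legal m s → Empty (Recontaminated (perform m s)) → Sound (after m s)
    sound-after m@(place j v) (sound C tracks admissible represented) (_ , ok) none =
      sound C (tracks-recontaminate tracks′ none) admissible′
        (released j (just v) admissible′ (uncontaminated-settled tracks′ none) represented)
      where
      tracks′ = tracks-perform m tracks
      admissible′ = admissible-update j (just v) (λ { _ refl → ok }) admissible
    sound-after m@(remove j) (sound C tracks admissible represented) _ none =
      sound C (tracks-recontaminate tracks′ none) admissible′
        (released j nothing admissible′ (uncontaminated-settled tracks′ none) represented)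
      where
      tracks′ = tracks-perform m tracks
      admissible′ = admissible-update j nothing (λ _ ()) admissible
    sound-after m@(slide j u e v) {s} (sound C tracks admissible represented) (pj≡u , euv , cj≡ce) none =
      sound (C ∪ˢ ⁅ e ⁆) (tracks-recontaminate tracks′ none) admissible′ represented′
      where
      tracks′ = tracks-perform m tracks
      settled′ = uncontaminated-settled tracks′ none
      admissible′ = admissible-update j (just v) (λ { _ refl → e , (u , joins-sym euv) , sym cj≡ce }) admissible
      represented′ : Represented (position (after m s)) (C ∪ˢ ⁅ e ⁆)
      represented′ with e ∈? C
      ... | no  e∉C = advanced j u e v pj≡u euv cj≡ce e∉C admissible′ settled′ represented
      -- `e` is clean already, so this slide counts as a release.
      ... | yes e∈C = released j (just v) admissible′ settled′ (subst (Represented (position s)) absorb represented)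
        where
        absorb : C ≡ C ∪ˢ ⁅ e ⁆
        absorb = ⊆-antisym (p⊆p∪q ⁅ e ⁆) λ {f} f∈ →
          [ id , (λ f∈e → subst (_∈ˢ C) (sym (x∈⁅y⁆⇒x≡y e f∈e)) e∈C) ]′ (x∈p∪q⁻ C ⁅ e ⁆ f∈)

    sound-initial : Sound initial
    sound-initial = sound ⊥ˢ tracks-initial (λ _ _ ()) (matched-represented {h = proj₂ start} (proj₁ closed)
      (guarding λ a v eq → contradiction (trans (sym (lookup-replicate a nothing)) eq) λ ()))

    -- At the end the cleaned set is full, and there the table has no record to represent the state.
    unsearchable : ∀ {s} S → Sound s → IsSearchFrom s S → ¬ MonotoneFrom s S
    unsearchable [] (sound C tracks _ (g , g∈ , _)) all _
      with refl ← ⊆-antisym ⊆⊤ (λ {e} _ → clean⊆ tracks e (all e)) with () ← subst (g ∈ᴸ_) unfinished g∈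
    unsearchable (m ∷ S) snd (legal , search) (none , monotone) =
      unsearchable S (sound-after m snd legal none) search monotone

    no-monotone-strategy : ∀ S → IsSearchStrategy S → ¬ Monotone S
    no-monotone-strategy S = unsearchable S sound-initial

-- Sections of maps between finite sets.

module _ {m n} (f : Fin n → Fin m) (σ : Fin m → Fin n) (f∘σ : ∀ a → f (σ a) ≡ a) where

  section-injective : Injective _≡_ _≡_ σ
  section-injective {a} {b} eq = trans (sym (f∘σ a)) (trans (cong f eq) (f∘σ b))

  private
    -- Punching out a missed `i` would inject `Fin m` into a set of `n - 1` elements.
    not-missed : n ≤ m → ∀ i → ¬ (∀ a → i ≢ σ a)
    not-missed = go σ section-injective
      where
      go : ∀ {n} (σ : Fin m → Fin n) → Injective _≡_ _≡_ σ → n ≤ m → ∀ i → ¬ (∀ a → i ≢ σ a)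
      go {suc n} σ inj n<m i i≢ = ℕ.<⇒≱ n<m
        (injective⇒≤ {f = λ a → punchOut (i≢ a)} λ {a} {b} → inj ∘ punchOut-injective (i≢ a) (i≢ b))

  -- The section `σ` is onto, hence also a left inverse of `f`.
  retraction-injective : n ≤ m → Injective _≡_ _≡_ f
  retraction-injective n≤m {i} {j} fi≡fj = trans (σ∘f i) (trans (cong σ fi≡fj) (sym (σ∘f j)))
    where
    σ∘f : ∀ i → i ≡ σ (f i)
    σ∘f i = decidable-stable (i ≟ σ (f i)) λ i≢ →
      not-missed n≤m i λ { a refl → i≢ (cong σ (sym (f∘σ a))) }

-- The spider and its tree structure.

spiderEnds : Vec (Fin 11 × Fin 11) 10
-- Vertex 0 is the centre. The legs 1 to 4, 5 to 7 and 8 to 10 take one row each, numbered outwards.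
spiderEnds = (0F , 1F) ∷ (1F , 2F) ∷ (2F , 3F) ∷ (3F , 4F)
           ∷ (0F , 5F) ∷ (5F , 6F) ∷ (6F , 7F)
           ∷ (0F , 8F) ∷ (8F , 9F) ∷ (9F , suc 9F) ∷ []

spiderColours : Vec (Fin 3) 10
spiderColours = 0F ∷ 1F ∷ 0F ∷ 2F
              ∷ 2F ∷ 0F ∷ 1F
              ∷ 2F ∷ 0F ∷ 1F ∷ []

spider-simple : ∀ e f → lookup spiderEnds e ≡ lookup spiderEnds f ⊎ lookup spiderEnds e ≡ Product.swap (lookup spiderEnds f) → e ≡ f
spider-simple = from-yes (all? λ e → all? λ f → (Product.≡-dec _≟_ _≟_ (lookup spiderEnds e) (lookup spiderEnds f) ⊎-dec
  Product.≡-dec _≟_ _≟_ (lookup spiderEnds e) (Product.swap (lookup spiderEnds f))) →-dec e ≟ f)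

spider : EdgeLabeledGraph
spider = record
  { order    = 11
  ; size     = 10
  ; palette  = 3
  ; ends     = lookup spiderEnds
  ; loopless = from-yes (all? λ e → ¬? (proj₁ (lookup spiderEnds e) ≟ proj₂ (lookup spiderEnds e)))
  ; simple   = λ {e} {f} → λ
      { (inj₁ p) (inj₁ q) → spider-simple e f (inj₁ (trans p (sym q)))
      ; (inj₁ p) (inj₂ q) → spider-simple e f (inj₂ (trans p (cong Product.swap (sym q))))
      ; (inj₂ p) (inj₁ q) → spider-simple e f (inj₂ (trans p (cong Product.swap (sym q))))
      ; (inj₂ p) (inj₂ q) → spider-simple e f (inj₁ (trans p (sym q)))
      }
  ; c        = lookup spiderColours
  }

open EdgeLabeledGraph spider using (Vertex; Edge; Joins; Adjacent; Path; Connected; IsTree; ends)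
open Graph spider using (joins?; endpoint?; adjacent?; acyclic)

-- The entry at `e` is the tip of its leg; the vertices beyond `e` form an interval ending there.
tips : Vec (Fin 11) 10
tips = 4F ∷ 4F ∷ 4F ∷ 4F ∷ 7F ∷ 7F ∷ 7F ∷ suc 9F ∷ suc 9F ∷ suc 9F ∷ []

-- Edge e has outer end suc e, so this tells whether v lies beyond e.
beyond : Edge → Vertex → Bool
beyond e v = does (suc (toℕ e) ℕ.≤? toℕ v) ∧ does (toℕ v ℕ.≤? toℕ (lookup tips e))

separates : ∀ e u v → Joins e u v → beyond e u ≢ beyond e v
separates = from-yes (all? λ e → all? λ u → all? λ v → joins? e u v →-dec ¬? (beyond e u Bool.≟ beyond e v))

unseparated : ∀ e f u v → f ≢ e → Joins f u v → beyond e u ≡ beyond e v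
unseparated = from-yes (all? λ e → all? λ f → all? λ u → all? λ v →
  ¬? (f ≟ e) →-dec joins? f u v →-dec beyond e u Bool.≟ beyond e v)

-- Follows an edge at `u` that separates it from `v` until none is left. The number is fuel; 11, the
-- order of the spider, bounds the length of every path.
route : ℕ → Vertex → Vertex → List Vertex
route zero    u v = []
route (suc n) u v = u ∷ onward (filter (λ e → endpoint? u e ×-dec ¬? (beyond e u Bool.≟ beyond e v)) (allFin 10))
  where
  onward : List Edge → List Vertex
  onward []      = []
  onward (e ∷ _) = if does (proj₁ (ends e) ≟ u) then route n (proj₂ (ends e)) v else route n (proj₁ (ends e)) v

IsPath : Vertex → Vertex → List Vertex → Set
IsPath u v xs = head xs ≡ just u × last xs ≡ just v × Linked Adjacent xs × Unique xs

isPath? : ∀ u v xs → Dec (IsPath u v xs)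
isPath? u v xs = Maybe.≡-dec _≟_ (head xs) (just u) ×-dec Maybe.≡-dec _≟_ (last xs) (just v) ×-dec
                 linked? adjacent? xs ×-dec unique? xs
  where open import Data.List.Relation.Unary.Unique.DecPropositional (_≟_ {11}) using (unique?)

path : ∀ {u v} xs → IsPath u v xs → Path u v
path xs (starts , stops , linked , distinct) =
  record { vertices = xs ; starts = starts ; stops = stops ; linked = linked ; distinct = distinct }

route-isPath : ∀ u v → IsPath u v (route 11 u v)
route-isPath = from-yes (all? λ u → all? λ v → isPath? u v (route 11 u v))

connected : Connected
connected u v = path (route 11 u v) (route-isPath u v)

spider-isTree : IsTree
spider-isTree = _ , connected , acyclic beyond (λ e → separates e _ _) (unseparated _ _ _ _)

colour-occurs : ∀ a → ∃[ e ] lookup spiderColours e ≡ a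
colour-occurs = from-yes (all? λ a → any? λ e → lookup spiderColours e ≟ a)

-- Search strategies on the spider.

module _ {n} (c̃ : Fin n → Fin 3) where
  open Search spider c̃
  open Searching spider c̃

  -- Some edge has colour `a`; it starts contaminated, so a searcher of that colour must clean it.
  searcher-of : ∀ {S} → IsSearchStrategy S → ∀ a → ∃[ j ] c̃ j ≡ a
  searcher-of {S} search a with e , refl ← colour-occurs a with inj₂ used ← colour-used S search e = used

module ThreeSearchers where
  open Search spider {3} id
  open Searching spider {3} id

  strategy : List Move
  strategy =
    -- The first leg is cleaned from the inside out to both ends, and searcher 2 then holds the
    -- centre. After edges 5 and 6, searcher 0 holds vertex 5 and searcher 1 goes to vertex 1, so
    -- that only edge 0 of the first leg can be lost.
    place 0F 2F ∷ place 1F 2F ∷ slide 0F 2F 2F 3F ∷ slide 1F 2F 1F 1F ∷ place 2F 3F ∷ remove 0F ∷ place 0F 0F ∷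
    slide 2F 3F 3F 4F ∷ remove 2F ∷ place 2F 0F ∷ slide 0F 0F 0F 1F ∷ remove 0F ∷ place 0F 6F ∷ remove 1F ∷
    place 1F 6F ∷ slide 0F 6F 5F 5F ∷ slide 1F 6F 6F 7F ∷ remove 1F ∷ place 1F 1F ∷
    -- Leaving the centre lets edge 0 be recontaminated, in exchange for edge 4.
    slide 2F 0F 4F 5F ∷ remove 0F ∷ place 0F 0F ∷ slide 2F 5F 4F 0F ∷ slide 0F 0F 0F 1F ∷ remove 0F ∷ place 0F 8F ∷
    remove 1F ∷ place 1F 9F ∷ slide 2F 0F 7F 8F ∷ slide 0F 8F 8F 9F ∷ slide 1F 9F 9F (suc 9F) ∷ []

  search : IsSearchStrategy strategy
  search = search-by-computation strategy tt

module FourSearchers where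
  c̃ : Fin 4 → Fin 3
  c̃ = lookup (0F ∷ 1F ∷ 2F ∷ 2F ∷ [])

  open Search spider c̃
  open Searching spider c̃

  strategy : List Move
  strategy =
    -- Of the two searchers of colour 2, searcher 2 waits at vertex 3 for edge 3, while searcher 3
    -- cleans edge 4 and holds the centre until edge 7.
    place 0F 5F ∷ place 1F 6F ∷ place 2F 3F ∷ place 3F 5F ∷ slide 0F 5F 5F 6F ∷ remove 0F ∷ place 0F 0F ∷
    slide 1F 6F 6F 7F ∷ remove 1F ∷ place 1F 1F ∷ slide 3F 5F 4F 0F ∷ slide 0F 0F 0F 1F ∷ remove 0F ∷ place 0F 2F ∷
    slide 1F 1F 1F 2F ∷ slide 0F 2F 2F 3F ∷ remove 0F ∷ place 0F 8F ∷ remove 1F ∷ place 1F 9F ∷ slide 2F 3F 3F 4F ∷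
    slide 3F 0F 7F 8F ∷ slide 0F 8F 8F 9F ∷ slide 1F 9F 9F (suc 9F) ∷ []

  search : IsSearchStrategy strategy
  search = search-by-computation strategy tt

  monotone : Monotone strategy
  monotone = monotone-by-computation strategy tt

-- Lower bounds and the conclusion.

open Exploration spider using (Family; Closed; closed?; explore; start; module Invariant)

-- The bound on the number of steps is ample; closed? would fail if it were not.
reachable : Family
reachable = explore 10000 (start ∷ []) (constant [])

reachable-closed : Closed reachable
reachable-closed = from-yes (closed? reachable)

reachable-unfinished : at reachable ⊤ˢ ≡ []
reachable-unfinished = refl

-- Choosing a searcher for each colour injects the three colours into the searchers.
searchable-≥3 : ∀ {n} → SearchableBy spider n → 3 ≤ n
searchable-≥3 (c̃ , S , search , _) = injective⇒≤
  (section-injective c̃ (proj₁ ∘ searcher-of c̃ search) (proj₂ ∘ searcher-of c̃ search))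

-- At most three searchers bearing all three colours have distinct colours, so the exploration
-- applies to them.
monotonicallySearchable-≥4 : ∀ {n} → MonotonicallySearchableBy spider n → 4 ≤ n
monotonicallySearchable-≥4 (c̃ , S , search , monotone , _) = ℕ.≰⇒> λ n≤3 →
  Invariant.no-monotone-strategy c̃
    (retraction-injective c̃ (proj₁ ∘ searcher-of c̃ search) (proj₂ ∘ searcher-of c̃ search) n≤3)
    reachable reachable-closed reachable-unfinished S search monotone

theorem3p1 : ∃[ T ] (EdgeLabeledGraph.IsTree T ×
    ∃[ mhs ] ∃[ hs ] (IsMhs T mhs × IsHs T hs × mhs > hs))
theorem3p1 = spider , spider-isTree , 4 , 3
  , ((FourSearchers.c̃ , FourSearchers.strategy , FourSearchers.search , FourSearchers.monotone , refl)
    , monotonicallySearchable-≥4)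
  , ((id , ThreeSearchers.strategy , ThreeSearchers.search , refl) , searchable-≥3)
  , ℕ.≤-refl
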